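{- Let $\mathcal{G}=(V,E)$ be a directed acyclic graph on the set of agents $V=\{1,\ldots,n\}$ such that every edge $(i,j)\in E$ satisfies $i<j$, let $\chi(\mathcal{G})=k$ be its chromatic number, and let $c:V\to\{1,\ldots,k\}$ be an optimal coloring of $\mathcal{G}$. Each agent $i\in V$ has the strategy set $X_i=\{a_i,b_i\}$ (these sets being disjoint) and must choose one strategy $x_i\in X_i$; the goal is to maximize $f(x_1,\ldots,x_n)$, where $X=\bigcup_i X_i$ and $f:2^X\to\mathbb{R}_{\ge 0}$ is the function defined in the context from the coloring $c$ through its marginal rewards. Let $(x_1^*,\ldots,x_n^*)$ be an optimal solution, i.e. a maximizer of $f(x_1,\ldots,x_n)$ over all choices $x_i\in X_i$. Suppose that the agents sequentially update their strategies $(x_1,\ldots,x_n)$, for $i=1,\ldots,n$, according to the greedy rule $$x_i=\operatorname{argmax}_{x\in X_i}\Delta\big(x\mid X_{\mathrm{in}}(i)\big),\qquad X_{\mathrm{in}}(i)=\{x_j:(j,i)\in E\},$$ where, if multiple strategies have equal marginal reward, one maximizer is selected arbitrarily. Then $$f(x_1,\ldots,x_n)\ \le\ \frac{\chi(\mathcal{G})}{n}\, f(x_1^*,\ldots,x_n^*).$$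
   Context: A coloring of $\mathcal{G}$ is an assignment $c$ of colors to the vertices such that $c(u)\ne c(v)$ for every edge $(u,v)\in E$; the chromatic number $\chi(\mathcal{G})$ is the minimum number of colors of a coloring, and an optimal coloring is one using $\chi(\mathcal{G})$ colors. For each color $\ell\le k$ put $V_\ell=\{v\in V: c(v)=\ell\}$. The function $f$ is defined through its marginal rewards. Let $S\subset X$ be a set with $|S\cap X_i|\le 1$ for all $i\in V$, containing decisions for a subset of the $n$ agents. The marginal reward of $a_i$ is $\Delta(a_i\mid S)=0$ if $a_j\in S$ for some $j\in V_{c(i)}$, and $\Delta(a_i\mid S)=1$ otherwise. The marginal reward of $b_i$ is $\Delta(b_i\mid S)=1$ for all $i\in V$. For $S=\{s_1,\ldots,s_m\}\subset X$ with $|S\cap X_i|\le 1$ for all $i\in V$, define $$f(S)=\sum_{i=1}^m\Delta\big(s_i\mid\{s_1,\ldots,s_{i-1}\}\big),$$ with $\{s_1,\ldots,s_0\}=\emptyset$. The notation $f(x_1,\ldots,x_n)$ means $f(\{x_1,\ldots,x_n\})$.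
   Formalization: The inequality is stated for some greedy outcome, i.e. for a suitable way of breaking ties, not for every one: for every tie-breaking it is false when χ(G) < n, since all agents choosing b_i is also a greedy outcome, with value n (e.g. n = 2, no edges: f = f* = 2, but the bound is 1). -}

module Defs where

open import Data.Bool using (if_then_else_)
open import Data.Fin using (Fin; _<_)
open import Data.Fin.Properties using (any?) renaming (_≟_ to _≟ᶠ_)
open import Data.Integer using (+_)
open import Data.List using (List; map; filter; allFin; zipWith; inits)
open import Data.List.Membership.DecPropositional using () renaming (_∈?_ to member?)
open import Data.Nat using (ℕ; _≤_)
open import Data.Nat.ListAction using (sum)
open import Data.Product using (Σ; ∃; _×_; _,_)
open import Data.Product.Properties using (≡-dec)
open import Data.Rational using (ℚ; _/_)
open import Level using (0ℓ)
open import Relation.Binary using (Rel; Decidable; DecidableEquality)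
open import Relation.Binary.Construct.Closure.Transitive using (TransClosure)
open import Relation.Binary.PropositionalEquality using (_≡_; _≢_; refl)
open import Relation.Nullary using (¬_; does; yes; no; _×-dec_)

record DAG (n : ℕ) : Set₁ where
  field
    Edge    : Rel (Fin n) 0ℓ
    edge?   : Decidable Edge
    acyclic : ∀ i → ¬ TransClosure Edge i i

open DAG public

EdgesIncrease : ∀ {n} → DAG n → Set
EdgesIncrease G = ∀ i j → Edge G i j → i < j

IsColoring : ∀ {n k} → DAG n → (Fin n → Fin k) → Set
IsColoring G c = ∀ u v → Edge G u v → c u ≢ c v

Colorable : ∀ {n} → DAG n → ℕ → Set
Colorable {n} G k = ∃ λ (c : Fin n → Fin k) → IsColoring G c

IsChromaticNumber : ∀ {n} → DAG n → ℕ → Set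
IsChromaticNumber G k = Colorable G k × (∀ m → Colorable G m → k ≤ m)

-- X i is the strategy set {aᵢ, bᵢ}; the agent is a parameter, so the
-- disjoint union of the strategy sets is AllStrategies below.
data X {n : ℕ} (i : Fin n) : Set where
  a b : X i

AllStrategies : ℕ → Set
AllStrategies n = Σ (Fin n) X

_≟ˣ_ : ∀ {n} {i : Fin n} → DecidableEquality (X i)
a ≟ˣ a = yes refl
a ≟ˣ b = no λ ()
b ≟ˣ a = no λ ()
b ≟ˣ b = yes refl

_≟_ : ∀ {n} → DecidableEquality (AllStrategies n)
_≟_ = ≡-dec _≟ᶠ_ _≟ˣ_

Profile : ℕ → Set
Profile n = (i : Fin n) → X i

-- A finite set of strategies {s₁,…,sₘ} is given by the list of its elements.
module _ {n k : ℕ} (c : Fin n → Fin k) where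

  Δ : AllStrategies n → List (AllStrategies n) → ℕ
  Δ (i , a) S =
    if does (any? λ j → (c j ≟ᶠ c i) ×-dec member? _≟_ (j , a) S) then 0 else 1
  Δ (i , b) S = 1

  -- inits S enumerates the prefixes ∅, {s₁}, {s₁,s₂}, …; zipWith drops the
  -- last one. On lists without repetitions the value does not depend on the
  -- order: it is the number of b's plus the number of colors among the a's.
  f : List (AllStrategies n) → ℕ
  f S = sum (zipWith Δ S (inits S))

  fᵖ : Profile n → ℕ
  fᵖ x = f (map (λ i → i , x i) (allFin n))

  IsOptimal : Profile n → Set
  IsOptimal x* = ∀ x → fᵖ x ≤ fᵖ x*

Xin : ∀ {n} → DAG n → Profile n → Fin n → List (AllStrategies n)
Xin {n} G x i = map (λ j → j , x j) (filter (λ j → edge? G j i) (allFin n))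

-- The possible outcomes of the sequential greedy updates. When edges increase,
-- Xin G x i only involves agents j < i, whose strategies are already final.
-- The argmax may be non-unique, so there are in general several such
-- profiles, one for each way of breaking the ties.
IsGreedy : ∀ {n k} → DAG n → (Fin n → Fin k) → Profile n → Set
IsGreedy G c x = ∀ i (y : X i) → Δ c (i , y) (Xin G x i) ≤ Δ c (i , x i) (Xin G x i)

fromℕ : ℕ → ℚ
fromℕ m = + m / 1

{-# OPTIONS --safe #-}
-- If every agent plays a, each choice is greedy: the in-neighbours have other
-- colors, so the observed marginal reward of a is 1, the largest possible. This
-- profile collects one reward per color, at most k in total, whereas
-- everybody playing b collects n.
module Submission where

open import Data.Bool using (if_then_else_; true; false)
open import Data.Fin using (Fin; zero; suc)
open import Data.Fin.Properties using (any?; injective⇒≤) renaming (_≟_ to _≟ᶠ_)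
open import Data.Integer using (+_)
import Data.Integer as ℤ
import Data.Integer.Properties as ℤ
open import Data.List using (List; []; _∷_; _++_; _∷ʳ_; length; lookup; map; allFin; zipWith; inits)
open import Data.List.Membership.DecPropositional using () renaming (_∈?_ to member?)
open import Data.List.Membership.Propositional using (_∈_)
open import Data.List.Membership.Propositional.Properties using (∈-map⁻; ∈-filter⁻; ∈-++⁺ˡ; ∈-++⁺ʳ; ∈-lookup)
open import Data.List.Properties using (++-assoc; ++-identityʳ; length-tabulate; map-∘; map-cong; map-id)
open import Data.List.Relation.Unary.All as All using (All; []; _∷_)
open import Data.List.Relation.Unary.All.Properties using (¬Any⇒All¬)
open import Data.List.Relation.Unary.Any using (here)
open import Data.List.Relation.Unary.Unique.Propositional using (Unique; []; _∷_)
open import Data.Nat as ℕ using (ℕ; suc; NonZero; z≤n; s≤s)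
open import Data.Nat.ListAction using (sum)
import Data.Nat.Properties as ℕ
open import Data.Product using (∃; _×_; _,_)
open import Data.Rational using (_/_; _*_; _≤_; toℚᵘ)
open import Data.Rational.Properties using (toℚᵘ-cancel-≤; toℚᵘ-fromℚᵘ; toℚᵘ-homo-*)
import Data.Rational.Unnormalised as ℚᵘ
import Data.Rational.Unnormalised.Properties as ℚᵘ
open import Relation.Binary.PropositionalEquality using (_≡_; refl; sym; trans; cong; cong₂; subst; module ≡-Reasoning)
open import Relation.Nullary using (¬_; contradiction; does; yes; no; _×-dec_)
open import Relation.Nullary.Decidable using (dec-true; dec-false)
open import Defs

lookup-injective : ∀ {A : Set} {xs : List A} → Unique xs →
  ∀ i j → lookup xs i ≡ lookup xs j → i ≡ j
lookup-injective (_  ∷ _) zero    zero    _  = refl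
lookup-injective (x∉ ∷ _) zero    (suc j) eq = contradiction eq (All.lookup x∉ (∈-lookup j))
lookup-injective (x∉ ∷ _) (suc i) zero    eq = contradiction (sym eq) (All.lookup x∉ (∈-lookup i))
lookup-injective (_  ∷ u) (suc i) (suc j) eq = cong suc (lookup-injective u i j eq)

-- Pigeonhole: looking up positions of a repetition-free list injects them into the `k` colors.
unique⇒length≤ : ∀ {k} {ℓs : List (Fin k)} → Unique ℓs → length ℓs ℕ.≤ k
unique⇒length≤ u = injective⇒≤ (lookup-injective u _ _)

module _ {n k : ℕ} (c : Fin n → Fin k) where

  -- This is exactly the proposition that the `any?` inside `Δ` decides, so a proof or a refutation
  -- of it evaluates the conditional.
  Occurs : Fin k → List (AllStrategies n) → Set
  Occurs ℓ S = ∃ λ j → c j ≡ ℓ × (j , a) ∈ S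

  Δ≤1 : ∀ s S → Δ c s S ℕ.≤ 1
  Δ≤1 (i , a) S with does (any? λ j → (c j ≟ᶠ c i) ×-dec member? _≟_ (j , a) S)
  ... | true  = z≤n
  ... | false = s≤s z≤n
  Δ≤1 (i , b) S = s≤s z≤n

  Δ-occurs : ∀ {i S} → Occurs (c i) S → Δ c (i , a) S ≡ 0
  Δ-occurs p = cong (if_then 0 else 1) (dec-true (any? _) p)

  Δ-fresh : ∀ {i S} → ¬ Occurs (c i) S → Δ c (i , a) S ≡ 1
  Δ-fresh ¬p = cong (if_then 0 else 1) (dec-false (any? _) ¬p)

  -- A form of `f` suited to induction: the prefix already processed is carried as `P` instead of
  -- being enumerated by `inits`.
  marginals : List (AllStrategies n) → List (AllStrategies n) → ℕ
  marginals P []      = 0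
  marginals P (s ∷ S) = Δ c s P ℕ.+ marginals (P ∷ʳ s) S

  -- The nonempty prefixes of `s ∷ S` are those of `S` with `s` put in front; reassociating moves
  -- `s` to the end of `P`, where the induction hypothesis applies.
  sum-zipWith-inits : ∀ P S → sum (zipWith (Δ c) S (map (P ++_) (inits S))) ≡ marginals P S
  sum-zipWith-inits P []      = refl
  sum-zipWith-inits P (s ∷ S) = cong₂ ℕ._+_ (cong (Δ c s) (++-identityʳ P)) (begin
    sum (zipWith (Δ c) S (map (P ++_) (map (s ∷_) (inits S))))
      ≡⟨ cong rewards (map-∘ (inits S)) ⟨
    sum (zipWith (Δ c) S (map (λ Q → P ++ s ∷ Q) (inits S)))
      ≡⟨ cong rewards (map-cong (++-assoc P (s ∷ [])) (inits S)) ⟨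
    sum (zipWith (Δ c) S (map ((P ∷ʳ s) ++_) (inits S)))
      ≡⟨ sum-zipWith-inits (P ∷ʳ s) S ⟩
    marginals (P ∷ʳ s) S ∎)
    where
    open ≡-Reasoning
    rewards : List (List (AllStrategies n)) → ℕ
    rewards Ps = sum (zipWith (Δ c) S Ps)

  f≡marginals : ∀ S → f c S ≡ marginals [] S
  f≡marginals S =
    trans (cong (λ Ps → sum (zipWith (Δ c) S Ps)) (sym (map-id (inits S)))) (sum-zipWith-inits [] S)

  marginals-b : ∀ P is → marginals P (map (λ i → i , b) is) ≡ length is
  marginals-b P []       = refl
  marginals-b P (i ∷ is) = cong suc (marginals-b _ is)

  -- ℓs lists colors that already occur in P; a positive reward adds a new one.
  marginals-a : ∀ P {ℓs} → Unique ℓs → All (λ ℓ → Occurs ℓ P) ℓs →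
    ∀ is → marginals P (map (λ i → i , a) is) ℕ.+ length ℓs ℕ.≤ k
  marginals-a P u occ [] = unique⇒length≤ u
  marginals-a P {ℓs} u occ (i ∷ is) = step
    where
    open ℕ.≤-Reasoning
    rest : ℕ
    rest = marginals (P ∷ʳ (i , a)) (map (λ i → i , a) is)

    occ′ : All (λ ℓ → Occurs ℓ (P ∷ʳ (i , a))) ℓs
    occ′ = All.map (λ (j , eq , j∈P) → j , eq , ∈-++⁺ˡ j∈P) occ

    step : Δ c (i , a) P ℕ.+ rest ℕ.+ length ℓs ℕ.≤ k
    step with member? _≟ᶠ_ (c i) ℓs
    -- A recorded color occurs in `P`, so the reward is 0 and `ℓs` stays as it is.
    ... | yes ci∈ℓs = begin
      Δ c (i , a) P ℕ.+ rest ℕ.+ length ℓs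
        ≡⟨ cong (λ d → d ℕ.+ rest ℕ.+ length ℓs) (Δ-occurs (All.lookup occ ci∈ℓs)) ⟩
      rest ℕ.+ length ℓs
        ≤⟨ marginals-a _ u occ′ is ⟩
      k ∎
    -- Here `c i` may still occur in `P`, as `ℓs` need not list every color there. The bound 1 on
    -- the reward suffices: recording `c i` lengthens `ℓs` by one and pays for it.
    ... | no ci∉ℓs = begin
      Δ c (i , a) P ℕ.+ rest ℕ.+ length ℓs
        ≤⟨ ℕ.+-monoˡ-≤ (length ℓs) (ℕ.+-monoˡ-≤ rest (Δ≤1 (i , a) P)) ⟩
      suc (rest ℕ.+ length ℓs)
        ≡⟨ ℕ.+-suc rest (length ℓs) ⟨
      rest ℕ.+ suc (length ℓs)
        ≤⟨ marginals-a _ (¬Any⇒All¬ ℓs ci∉ℓs ∷ u)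
             ((i , refl , ∈-++⁺ʳ P (here refl)) ∷ occ′) is ⟩
      k ∎

  fᵖ-b : fᵖ c (λ _ → b) ≡ n
  fᵖ-b = begin
    fᵖ c (λ _ → b)                                ≡⟨ f≡marginals (map (λ i → i , b) (allFin n)) ⟩
    marginals [] (map (λ i → i , b) (allFin n))   ≡⟨ marginals-b [] (allFin n) ⟩
    length (allFin n)                             ≡⟨ length-tabulate (λ i → i) ⟩
    n                                             ∎
    where open ≡-Reasoning

  fᵖ-a : fᵖ c (λ _ → a) ℕ.≤ k
  fᵖ-a = begin
    fᵖ c (λ _ → a)                                      ≡⟨ f≡marginals (map (λ i → i , a) (allFin n)) ⟩
    marginals [] (map (λ i → i , a) (allFin n))         ≡⟨ ℕ.+-identityʳ _ ⟨
    marginals [] (map (λ i → i , a) (allFin n)) ℕ.+ 0   ≤⟨ marginals-a [] [] [] (allFin n) ⟩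
    k                                                   ∎
    where open ℕ.≤-Reasoning

  greedy-a : (G : DAG n) → IsColoring G c → IsGreedy G c (λ _ → a)
  greedy-a G col i y = subst (Δ c (i , y) S ℕ.≤_) (sym (Δ-fresh unseen)) (Δ≤1 (i , y) S)
    where
    S : List (AllStrategies n)
    S = Xin G (λ _ → a) i

    unseen : ¬ Occurs (c i) S
    unseen (j , cj≡ci , j∈S) with ∈-map⁻ (λ j → j , a) j∈S
    -- The map yields the agent `j`, the filter its edge into `i`; a proper coloring rules out equal
    -- colors across that edge.
    ... | j , j∈in , refl with ∈-filter⁻ (λ j → edge? G j i) {xs = allFin n} j∈in
    ... | _ , edge = col j i edge cj≡ci

-- Cross-multiplying leaves `m * n ≤ k * M`, the product of the two hypotheses. Passing to
-- unnormalised rationals keeps the gcd reduction of `/` out of the computation.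
fromℕ-≤-/* : ∀ {m k n M} .{{_ : NonZero n}} → m ℕ.≤ k → n ℕ.≤ M →
  fromℕ m ≤ (+ k / n) * fromℕ M
fromℕ-≤-/* {m} {k} {suc n} {M} m≤k n≤M = toℚᵘ-cancel-≤ (begin
  toℚᵘ (fromℕ m)                          ≃⟨ toℚᵘ-fromℚᵘ (ℚᵘ.mkℚᵘ (+ m) 0) ⟩
  -- `mkℚᵘ` stores the denominator minus one: 0 stands for 1, and `n` below for `suc n`.
  ℚᵘ.mkℚᵘ (+ m) 0                         ≤⟨ ℚᵘ.*≤* cross ⟩
  ℚᵘ.mkℚᵘ (+ k) n ℚᵘ.* ℚᵘ.mkℚᵘ (+ M) 0
    ≃⟨ ℚᵘ.*-cong (toℚᵘ-fromℚᵘ (ℚᵘ.mkℚᵘ (+ k) n)) (toℚᵘ-fromℚᵘ (ℚᵘ.mkℚᵘ (+ M) 0)) ⟨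
  toℚᵘ (+ k / suc n) ℚᵘ.* toℚᵘ (fromℕ M)  ≃⟨ toℚᵘ-homo-* (+ k / suc n) (fromℕ M) ⟨
  toℚᵘ ((+ k / suc n) * fromℕ M)          ∎)
  where
  open ℚᵘ.≤-Reasoning
  cross : + m ℤ.* + (suc n ℕ.* 1) ℤ.≤ + k ℤ.* + M ℤ.* + 1
  cross rewrite ℕ.*-identityʳ n | ℤ.*-identityʳ (+ k ℤ.* + M)
              | sym (ℤ.pos-* m (suc n)) | sym (ℤ.pos-* k M)
    = ℤ.+≤+ (ℕ.*-mono-≤ m≤k n≤M)

propositionV1 : (n : ℕ) .{{_ : NonZero n}} (G : DAG n) → EdgesIncrease G →
    (k : ℕ) → IsChromaticNumber G k →
    (c : Fin n → Fin k) → IsColoring G c →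
    (x* : Profile n) → IsOptimal c x* →
    ∃ λ (x : Profile n) → IsGreedy G c x × fromℕ (fᵖ c x) ≤ (+ k / n) * fromℕ (fᵖ c x*)
propositionV1 n G _ k _ c col x* opt =
  (λ _ → a) , greedy-a c G col ,
  -- Comparing the optimum with the all-`b` profile gives `n ≤ fᵖ c x*`.
  fromℕ-≤-/* (fᵖ-a c) (subst (ℕ._≤ fᵖ c x*) (fᵖ-b c) (opt (λ _ → b)))
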